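{- Fix an even integer $k\ge0$ and let $(x_n)_{n\ge1}$ be the sequence of positive integers defined by $x_{n+2}=\varphi(x_{n+1})+\varphi(x_n)+k$ for all $n\in\mathbb{N}$, with starting values $x_1,x_2\in\mathbb{N}$, where $\varphi$ is Euler's totient function. Then $$\sup_{n\in\mathbb{N}}x_n\le 4^{X^{3^{k+1}}},\qquad\text{where } X:=\frac{3x_1+5x_2+7k}{2}.$$ In particular, $(x_n)_{n\ge1}$ is eventually periodic (i.e., there exists $T\in\mathbb{N}$ with $x_{n+T}=x_n$ for all sufficiently large $n$).
   Context: $\mathbb{N}$ denotes the set of positive integers; $\varphi(n)$ is the number of integers in $\{1,\ldots,n\}$ coprime to $n$. -}

module Defs where

open import Data.Nat using (ℕ; suc)
open import Data.List using (List; length; filter; map; upTo)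
open import Data.Nat.Coprimality using (Coprime; coprime?)

φ : ℕ → ℕ
φ n = length (filter (λ i → coprime? i n) (map suc (upTo n)))

{-# OPTIONS --safe #-}

-- Write v for half of the terms, which are even from some point on, and ℓ n = v n − φ (2 v n) ≥ 0.
-- Then 2 v (n+2) = v (n+1) + v n + k − ℓ n − ℓ (n+1), so v grows at most linearly in time, and both
-- ∑ ℓ and ∑ |v (n+1) − v n| over n < M are O(kM).  If an odd d > 1 divides v n then ℓ n ≥ v n / d.
-- Hence, for at least about half of the times n, the difference v (n+1) − v n is O(k) and v n is
-- either small or rough (without odd divisor 1 < d < 2R).  Suppose the pairs (v n , v (n+1)) are
-- distinct for n < N.  Then few v n are small, and (d , n) ↦ (d · v n , v (n+1) − v n) is injective
-- on odd d < 2R and rough times n ≤ N / d, because products of odd d < 2R with rough numbers factor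
-- uniquely.  Its values lie in a set of size O(k² N), whereas its domain has size of order
-- N · ∑ 1/d over odd d < 2R, which is larger once R is about exp(O(k²)).  So a pair repeats before
-- an explicit time N; from there on the sequence is periodic, and it is bounded by its first N terms.
module Submission where

open import Defs
open import Data.Fin as Fin using (fromℕ<)
open import Data.Fin.Properties using (injective⇒≤; fromℕ<-injective)
open import Data.List using (List; []; _∷_; _++_; length; lookup; map; filter; upTo; applyUpTo; cartesianProduct)
open import Data.List.Membership.Propositional using (_∈_)
open import Data.List.Membership.Propositional.Properties using (∈-lookup; ∈-filter⁻; ∈-upTo⁻; ∈-cartesianProduct⁻)
open import Data.List.Properties using (length-++; filter-++)
open import Data.List.Relation.Unary.All as All using ()
open import Data.List.Relation.Unary.AllPairs using (_∷_)
open import Data.List.Relation.Unary.Unique.Propositional using (Unique)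
open import Data.List.Relation.Unary.Unique.Propositional.Properties using (filter⁺; upTo⁺; cartesianProduct⁺)
open import Data.Nat
open import Data.Nat.Coprimality using (Coprime; coprime?; coprime-divisor; 1-coprimeTo)
open import Data.Nat.Divisibility
open import Data.Nat.Induction using (<-rec)
open import Data.Nat.Properties
open import Data.Nat.Tactic.RingSolver using (solve-∀)
open import Data.Product using (_×_; _,_; proj₁; proj₂; ∃-syntax; uncurry)
open import Data.Sum using (_⊎_; inj₁; inj₂)
open import Function using (_∘_; id)
open import Relation.Binary.Definitions using (tri<; tri≈; tri>)
open import Relation.Binary.PropositionalEquality hiding (J)
open import Relation.Nullary using (Dec; yes; no; ¬_; contradiction)
open import Relation.Nullary.Decidable using (_×-dec_; ¬?; decidable-stable)
open import Relation.Unary using (Decidable)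

-- Finite sums and counting

∑ : (ℕ → ℕ) → ℕ → ℕ
∑ f zero    = 0
∑ f (suc n) = ∑ f n + f n

∑-+ : ∀ f m n → ∑ f (m + n) ≡ ∑ f m + ∑ (λ i → f (m + i)) n
∑-+ f m zero rewrite +-identityʳ m = sym (+-identityʳ _)
∑-+ f m (suc n) rewrite +-suc m n | ∑-+ f m n = +-assoc (∑ f m) _ _

∑-cong : ∀ {f g} n → (∀ i → i < n → f i ≡ g i) → ∑ f n ≡ ∑ g n
∑-cong zero    _ = refl
∑-cong (suc n) h = cong₂ _+_ (∑-cong n λ i i<n → h i (m<n⇒m<1+n i<n)) (h n ≤-refl)

∑-mono : ∀ {f g} n → (∀ i → i < n → f i ≤ g i) → ∑ f n ≤ ∑ g n
∑-mono zero    _ = z≤n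
∑-mono (suc n) h = +-mono-≤ (∑-mono n λ i i<n → h i (m<n⇒m<1+n i<n)) (h n ≤-refl)

∑-mono-prefix : ∀ {f g m n} → m ≤ n → (∀ i → i < m → f i ≤ g i) → ∑ f m ≤ ∑ g n
∑-mono-prefix {f} {g} {m} {n} m≤n h = begin
  ∑ f m                                     ≤⟨ ∑-mono m h ⟩
  ∑ g m                                     ≤⟨ m≤m+n _ _ ⟩
  ∑ g m + ∑ (λ i → g (m + i)) (n ∸ m)       ≡⟨ ∑-+ g m (n ∸ m) ⟨
  ∑ g (m + (n ∸ m))                         ≡⟨ cong (∑ g) (m+[n∸m]≡n m≤n) ⟩
  ∑ g n                                     ∎
  where open ≤-Reasoning

∑-const : ∀ c n → ∑ (λ _ → c) n ≡ n * c
∑-const c zero    = refl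
∑-const c (suc n) = trans (cong (_+ c) (∑-const c n)) (+-comm _ c)

∑-distrib-+ : ∀ f g n → ∑ (λ i → f i + g i) n ≡ ∑ f n + ∑ g n
∑-distrib-+ f g zero = refl
∑-distrib-+ f g (suc n) rewrite ∑-distrib-+ f g n = lemma (∑ f n) (∑ g n) (f n) (g n)
  where
  lemma : ∀ a b c d → a + b + (c + d) ≡ a + c + (b + d)
  lemma = solve-∀

∑-distribˡ-* : ∀ c f n → ∑ (λ i → c * f i) n ≡ c * ∑ f n
∑-distribˡ-* c f zero = sym (*-zeroʳ c)
∑-distribˡ-* c f (suc n) rewrite ∑-distribˡ-* c f n = sym (*-distribˡ-+ c _ _)

∑-* : ∀ f d t → ∑ f (d * t) ≡ ∑ (λ j → ∑ (λ i → f (d * j + i)) d) t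
∑-* f d zero rewrite *-zeroʳ d = refl
∑-* f d (suc t) = begin
  ∑ f (d * suc t)                                 ≡⟨ cong (∑ f) (trans (*-suc d t) (+-comm d _)) ⟩
  ∑ f (d * t + d)                                 ≡⟨ ∑-+ f (d * t) d ⟩
  ∑ f (d * t) + ∑ (λ i → f (d * t + i)) d         ≡⟨ cong (_+ ∑ (λ i → f (d * t + i)) d) (∑-* f d t) ⟩
  _                                               ∎
  where open ≡-Reasoning

-- The two outermost terms are equal by symmetry and together give `2 * g 0`; the induction peels
-- them off. In odd length the unpaired central term vanishes.
∑-symmetric-even : ∀ m g → (∀ i j → i + j + 1 ≡ m → g i ≡ g j) →
                   (∀ i → i + i + 1 ≡ m → g i ≡ 0) → 2 ∣ ∑ g m
∑-symmetric-even zero    g _ _ = divides 0 refl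
∑-symmetric-even (suc zero) g _ centre rewrite centre 0 refl = divides 0 refl
∑-symmetric-even (suc (suc m)) g symm centre =
  subst (2 ∣_) (sym eq) (∣m∣n⇒∣m+n (divides (g 0) (sym (*-comm (g 0) 2))) ih)
  where
  shift : ∀ i j → suc i + suc j + 1 ≡ suc (suc (i + j + 1))
  shift = solve-∀
  ih : 2 ∣ ∑ (g ∘ suc) m
  ih = ∑-symmetric-even m (g ∘ suc)
    (λ i j e → symm (suc i) (suc j) (trans (shift i j) (cong (2 +_) e)))
    (λ i e → centre (suc i) (trans (shift i i) (cong (2 +_) e)))
  rearrange : ∀ a b → a + b + a ≡ 2 * a + b
  rearrange = solve-∀
  eq : ∑ g (suc (suc m)) ≡ 2 * g 0 + ∑ (g ∘ suc) m
  eq = begin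
    ∑ g (suc m) + g (suc m)            ≡⟨ cong (∑ g (suc m) +_) (symm 0 (suc m) (+-comm (suc m) 1)) ⟨
    ∑ g (suc m) + g 0                  ≡⟨ cong (_+ g 0) (∑-+ g 1 m) ⟩
    g 0 + ∑ (g ∘ suc) m + g 0          ≡⟨ rearrange (g 0) _ ⟩
    2 * g 0 + ∑ (g ∘ suc) m            ∎
    where open ≡-Reasoning

-- Indicators, filtered lists and the pigeonhole principle

𝟙 : {P : Set} → Dec P → ℕ
𝟙 (yes _) = 1
𝟙 (no  _) = 0

𝟙≤1 : {P : Set} (P? : Dec P) → 𝟙 P? ≤ 1
𝟙≤1 (yes _) = ≤-refl
𝟙≤1 (no  _) = z≤n

𝟙-true : {P : Set} (P? : Dec P) → P → 𝟙 P? ≡ 1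
𝟙-true (yes _) _ = refl
𝟙-true (no ¬p) p = contradiction p ¬p

𝟙-false : {P : Set} (P? : Dec P) → ¬ P → 𝟙 P? ≡ 0
𝟙-false (yes p) ¬p = contradiction p ¬p
𝟙-false (no  _) _  = refl

𝟙-mono : {P Q : Set} (P? : Dec P) (Q? : Dec Q) → (P → Q) → 𝟙 P? ≤ 𝟙 Q?
𝟙-mono (no  _) _  _ = z≤n
𝟙-mono (yes p) Q? f = ≤-reflexive (sym (𝟙-true Q? (f p)))

length-filter-applyUpTo : {A : Set} {P : A → Set} (P? : Decidable P) (f : ℕ → A) (n : ℕ) →
                          length (filter P? (applyUpTo f n)) ≡ ∑ (λ i → 𝟙 (P? (f i))) n
length-filter-applyUpTo P? f zero = refl
length-filter-applyUpTo P? f (suc n) =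
  trans head (sym (∑-+ (λ i → 𝟙 (P? (f i))) 1 n))
  where
  head : length (filter P? (applyUpTo f (suc n))) ≡ 𝟙 (P? (f 0)) + ∑ (λ i → 𝟙 (P? (f (suc i)))) n
  head with P? (f 0)
  ... | yes _ = cong suc (length-filter-applyUpTo P? (f ∘ suc) n)
  ... | no  _ = length-filter-applyUpTo P? (f ∘ suc) n

length-filter-map : {A B : Set} {P : B → Set} (P? : Decidable P) (f : A → B) (xs : List A) →
                    length (filter P? (map f xs)) ≡ length (filter (P? ∘ f) xs)
length-filter-map P? f [] = refl
length-filter-map P? f (x ∷ xs) with P? (f x)
... | yes _ = cong suc (length-filter-map P? f xs)
... | no  _ = length-filter-map P? f xs

length-filter-grid : {P : ℕ × ℕ → Set} (P? : Decidable P) (f : ℕ → ℕ) (m n : ℕ) →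
                     length (filter P? (cartesianProduct (applyUpTo f m) (upTo n)))
                       ≡ ∑ (λ e → ∑ (λ i → 𝟙 (P? (f e , i))) n) m
length-filter-grid P? f zero    n = refl
length-filter-grid P? f (suc m) n = begin
  length (filter P? (row ++ rest))                   ≡⟨ cong length (filter-++ P? row rest) ⟩
  length (filter P? row ++ filter P? rest)           ≡⟨ length-++ (filter P? row) ⟩
  length (filter P? row) + length (filter P? rest)
    ≡⟨ cong₂ _+_ (trans (length-filter-map P? (f 0 ,_) (upTo n))
                        (length-filter-applyUpTo (λ i → P? (f 0 , i)) id n))
                 (length-filter-grid P? (f ∘ suc) m n) ⟩
  ∑ (λ i → 𝟙 (P? (f 0 , i))) n + ∑ (λ e → ∑ (λ i → 𝟙 (P? (f (suc e) , i))) n) m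
    ≡⟨ ∑-+ (λ e → ∑ (λ i → 𝟙 (P? (f e , i))) n) 1 m ⟨
  _                                                  ∎
  where
  open ≡-Reasoning
  row rest : List (ℕ × ℕ)
  row  = map (f 0 ,_) (upTo n)
  rest = cartesianProduct (applyUpTo (f ∘ suc) m) (upTo n)

lookup-injective : {A : Set} {xs : List A} → Unique xs → ∀ i j → lookup xs i ≡ lookup xs j → i ≡ j
lookup-injective (_ ∷ _)  Fin.zero    Fin.zero    _  = refl
lookup-injective (p ∷ _)  Fin.zero    (Fin.suc j) eq = contradiction eq (All.lookup p (∈-lookup j))
lookup-injective (p ∷ _)  (Fin.suc i) Fin.zero    eq = contradiction (sym eq) (All.lookup p (∈-lookup i))
lookup-injective (_ ∷ ps) (Fin.suc i) (Fin.suc j) eq = cong Fin.suc (lookup-injective ps i j eq)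

pigeonhole : {A : Set} {xs : List A} {B : ℕ} → Unique xs → (f : A → ℕ) →
             (∀ {x} → x ∈ xs → f x < B) →
             (∀ {x y} → x ∈ xs → y ∈ xs → f x ≡ f y → x ≡ y) → length xs ≤ B
pigeonhole {xs = xs} uniq f bounded inj =
  injective⇒≤ {f = λ i → fromℕ< (bounded (∈-lookup i))} λ {i} {j} eq →
    lookup-injective uniq i j (inj (∈-lookup i) (∈-lookup j) (fromℕ<-injective _ _ _ _ eq))

-- Euler's totient

φ-∑ : ∀ n → φ n ≡ ∑ (λ i → 𝟙 (coprime? (suc i) n)) n
φ-∑ n = trans (length-filter-map (λ i → coprime? i n) suc (upTo n))
              (length-filter-applyUpTo (λ i → coprime? (suc i) n) id n)

φ≤n : ∀ n → φ n ≤ n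
φ≤n n = begin
  φ n                ≡⟨ φ-∑ n ⟩
  _                  ≤⟨ ∑-mono n (λ i _ → 𝟙≤1 (coprime? (suc i) n)) ⟩
  ∑ (λ _ → 1) n      ≡⟨ trans (∑-const 1 n) (*-identityʳ n) ⟩
  n                  ∎
  where open ≤-Reasoning

φ-positive : ∀ n → 1 ≤ n → 1 ≤ φ n
φ-positive (suc n) _ = begin
  1                                     ≡⟨ 𝟙-true (coprime? 1 (suc n)) (1-coprimeTo (suc n)) ⟨
  𝟙 (coprime? 1 (suc n))                ≤⟨ m≤m+n _ _ ⟩
  _                                     ≡⟨ ∑-+ (λ i → 𝟙 (coprime? (suc i) (suc n))) 1 n ⟨
  _                                     ≡⟨ φ-∑ (suc n) ⟨
  φ (suc n)                             ∎
  where open ≤-Reasoning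

common-divisor⇒¬coprime : ∀ {m n d} → 2 ≤ d → d ∣ m → d ∣ n → ¬ Coprime m n
common-divisor⇒¬coprime 2≤d d∣m d∣n c = <⇒≢ 2≤d (sym (c (d∣m , d∣n)))

coprime-reflect : ∀ {i j n} → i + j ≡ n → Coprime i n → Coprime j n
coprime-reflect refl c {d} (d∣j , d∣n) = c (∣m+n∣n⇒∣m d∣n d∣j , d∣n)
  where
  ∣m+n∣n⇒∣m : ∀ {i m n} → i ∣ m + n → i ∣ n → i ∣ m
  ∣m+n∣n⇒∣m {i} {m} {n} p q = ∣m+n∣m⇒∣n (subst (i ∣_) (+-comm m n) p) q

-- The map `a ↦ n - a` preserves coprimality to `n` and pairs the integers below `n`. Its possible
-- fixed point `n / 2` is at least 2 and divides `n`, so it is not counted.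
φ-even : ∀ n → 3 ≤ n → 2 ∣ φ n
φ-even (suc n) (s≤s 2≤n) = subst (2 ∣_) (sym eq) (∑-symmetric-even n g symm centre)
  where
  g : ℕ → ℕ
  g i = 𝟙 (coprime? (suc i) (suc n))
  last : g n ≡ 0
  last = 𝟙-false (coprime? (suc n) (suc n))
    (common-divisor⇒¬coprime (m≤n⇒m≤1+n 2≤n) ∣-refl ∣-refl)
  eq : φ (suc n) ≡ ∑ g n
  eq = trans (φ-∑ (suc n)) (trans (cong (∑ g n +_) last) (+-identityʳ _))
  shift : ∀ i j → suc i + suc j ≡ suc (i + j + 1)
  shift = solve-∀
  symm : ∀ i j → i + j + 1 ≡ n → g i ≡ g j
  symm i j e = ≤-antisym
    (𝟙-mono (coprime? _ _) (coprime? _ _) (coprime-reflect {suc i} {suc j} i+j))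
    (𝟙-mono (coprime? _ _) (coprime? _ _) (coprime-reflect {suc j} {suc i} (trans (+-comm (suc j) _) i+j)))
    where
    i+j : suc i + suc j ≡ suc n
    i+j = trans (shift i j) (cong suc e)
  centre : ∀ i → i + i + 1 ≡ n → g i ≡ 0
  centre zero    refl = contradiction 2≤n λ { (s≤s ()) }
  centre (suc i) refl = 𝟙-false (coprime? _ _)
    (common-divisor⇒¬coprime {d = suc (suc i)} (s≤s (s≤s z≤n)) ∣-refl
      (divides 2 (double i)))
    where
    double : ∀ i → suc (suc i + suc i + 1) ≡ 2 * suc (suc i)
    double = solve-∀

-- Index `i` stands for the odd number `2i + 1`. Even numbers are never coprime to `2 * v`, so the
-- `v` odd numbers below `2 * v` carry the whole totient.
oddCoprime : ℕ → ℕ → ℕ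
oddCoprime v i = 𝟙 (coprime? (suc (2 * i)) (2 * v))

φ-double : ∀ v → φ (2 * v) ≡ ∑ (oddCoprime v) v
φ-double v = begin
  φ (2 * v)                                 ≡⟨ φ-∑ (2 * v) ⟩
  ∑ f (2 * v)                               ≡⟨ ∑-* f 2 v ⟩
  ∑ (λ j → f (2 * j + 0) + f (2 * j + 1)) v ≡⟨ ∑-cong v (λ j _ → pair j) ⟩
  ∑ (oddCoprime v) v                        ∎
  where
  open ≡-Reasoning
  f : ℕ → ℕ
  f i = 𝟙 (coprime? (suc i) (2 * v))
  next : ∀ j → suc (2 * j + 1) ≡ suc j * 2
  next = solve-∀
  pair : ∀ j → f (2 * j + 0) + f (2 * j + 1) ≡ oddCoprime v j
  pair j rewrite 𝟙-false (coprime? (suc (2 * j + 1)) (2 * v))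
                   (common-divisor⇒¬coprime ≤-refl (divides (suc j) (next j)) (m∣m*n v))
               | +-identityʳ (2 * j) = +-identityʳ _

φ-double-≤ : ∀ v → φ (2 * v) ≤ v
φ-double-≤ v = begin
  φ (2 * v)                ≡⟨ φ-double v ⟩
  ∑ (oddCoprime v) v       ≤⟨ ∑-mono v (λ i _ → 𝟙≤1 (coprime? (suc (2 * i)) (2 * v))) ⟩
  ∑ (λ _ → 1) v            ≡⟨ trans (∑-const 1 v) (*-identityʳ v) ⟩
  v                        ∎
  where open ≤-Reasoning

∑≤-with-zero : ∀ f e m → (∀ i → f i ≤ 1) → f e ≡ 0 → ∑ f (suc (e + m)) ≤ e + m
∑≤-with-zero f e m f≤1 fe≡0 = begin
  ∑ f (suc (e + m))                                    ≡⟨ ∑-+ f (suc e) m ⟩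
  ∑ f e + f e + ∑ (λ i → f (suc e + i)) m              ≤⟨ +-mono-≤ (+-mono-≤ (∑≤n f e f≤1) (≤-reflexive fe≡0)) (∑≤n _ m (λ i → f≤1 _)) ⟩
  e + 0 + m                                            ≡⟨ cong (_+ m) (+-identityʳ e) ⟩
  e + m                                                ∎
  where
  open ≤-Reasoning
  ∑≤n : ∀ f n → (∀ i → f i ≤ 1) → ∑ f n ≤ n
  ∑≤n f n h = ≤-trans (∑-mono n (λ i _ → h i)) (≤-reflexive (trans (∑-const 1 n) (*-identityʳ n)))

-- Among the d odd residues modulo 2d, the residue d is not coprime to 2v.
φ-double-loss : ∀ e v → 1 ≤ e → (1 + 2 * e) ∣ v → v ≤ (1 + 2 * e) * (v ∸ φ (2 * v))
φ-double-loss e v 1≤e (divides t refl) = begin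
  t * d                    ≡⟨ *-comm t d ⟩
  d * t                    ≤⟨ *-monoʳ-≤ d (m+n≤o⇒m≤o∸n t bound) ⟩
  d * (t * d ∸ φ (2 * (t * d))) ∎
  where
  open ≤-Reasoning
  d : ℕ
  d = 1 + 2 * e
  f : ℕ → ℕ
  f = oddCoprime (t * d)
  middle : ∀ e j → suc (2 * ((1 + 2 * e) * j + e)) ≡ suc (2 * j) * (1 + 2 * e)
  middle = solve-∀
  2≤d : 2 ≤ d
  2≤d = s≤s (≤-trans 1≤e (m≤m+n e _))
  -- Index `d * j + e` stands for the odd number `d * (2j + 1)`, so every block of `d` indices
  -- contains a vanishing term.
  f-middle : ∀ j → f (d * j + e) ≡ 0
  f-middle j = 𝟙-false (coprime? (suc (2 * (d * j + e))) (2 * (t * d)))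
    (common-divisor⇒¬coprime 2≤d (divides (suc (2 * j)) (middle e j)) (∣n⇒∣m*n 2 (n∣m*n t)))
  block : ∀ j → ∑ (λ i → f (d * j + i)) d ≤ 2 * e
  block j = subst (λ c → ∑ (λ i → f (d * j + i)) (suc c) ≤ c) (cong (e +_) (sym (+-identityʳ e)))
    (∑≤-with-zero (λ i → f (d * j + i)) e e (λ i → 𝟙≤1 (coprime? (suc (2 * (d * j + i))) (2 * (t * d)))) (f-middle j))
  bound : t + φ (2 * (t * d)) ≤ t * d
  bound = begin
    t + φ (2 * (t * d))                                   ≡⟨ cong (t +_) (φ-double (t * d)) ⟩
    t + ∑ f (t * d)                                       ≡⟨ cong (λ z → t + ∑ f z) (*-comm t d) ⟩
    t + ∑ f (d * t)                                       ≡⟨ cong (t +_) (∑-* f d t) ⟩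
    t + ∑ (λ j → ∑ (λ i → f (d * j + i)) d) t             ≤⟨ +-monoʳ-≤ t (∑-mono t (λ j _ → block j)) ⟩
    t + ∑ (λ _ → 2 * e) t                                 ≡⟨ cong (t +_) (∑-const (2 * e) t) ⟩
    t + t * (2 * e)                                       ≡⟨ *-suc t (2 * e) ⟨
    t * d                                                 ∎

-- Growth and loss

∣-∣≤ : ∀ {a b c} → a ≤ b + c → b ≤ a + c → ∣ a - b ∣ ≤ c
∣-∣≤ {a} {b} {c} p q with ∣m-n∣≡[m∸n]∨[n∸m] a b
... | inj₁ eq = subst (_≤ c) (sym eq) (m≤n+o⇒m∸n≤o a b p)
... | inj₂ eq = subst (_≤ c) (sym eq) (m≤n+o⇒m∸n≤o b a q)

-- Uniqueness of quotient and remainder: it lets a pair be coded as one number for the pigeonhole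
-- principle.
*+-injective : ∀ m {a b a′ b′} → b < m → b′ < m → a * m + b ≡ a′ * m + b′ → a ≡ a′ × b ≡ b′
*+-injective m {a} {b} {a′} {b′} b<m b′<m eq = a≡a′ , +-cancelˡ-≡ (a * m) b b′ (trans eq (cong (λ z → z * m + b′) (sym a≡a′)))
  where
  apart : ∀ {a b a′ b′} → b < m → a < a′ → a * m + b < a′ * m + b′
  apart {a} {b} {a′} {b′} b<m a<a′ = begin-strict
    a * m + b     <⟨ +-monoʳ-< (a * m) b<m ⟩
    a * m + m     ≡⟨ +-comm (a * m) m ⟩
    suc a * m     ≤⟨ *-monoˡ-≤ m a<a′ ⟩
    a′ * m        ≤⟨ m≤m+n _ b′ ⟩
    a′ * m + b′   ∎
    where open ≤-Reasoning
  a≡a′ : a ≡ a′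
  a≡a′ = ≤-antisym (≮⇒≥ λ lt → <⇒≢ (apart b′<m lt) (sym eq)) (≮⇒≥ λ lt → <⇒≢ (apart b<m lt) eq)

-- The blocks 2ʲ ≤ e < 2ʲ⁺¹ contribute equally to ∑ 1/(1 + 2e), which makes this sum diverge.
dyadic-sum : ∀ J t (F : ℕ → ℕ) → (∀ e M → e < 2 ^ J → (1 + 2 * e) * M ≤ 2 * (2 ^ J * t) → M ≤ F e) →
             J * (2 ^ J * t) ≤ 2 * ∑ F (2 ^ J)
dyadic-sum zero    t F h = z≤n
dyadic-sum (suc J) t F h = begin
  suc J * (2 * R * t)                              ≡⟨ arith J R t ⟩
  J * (R * (2 * t)) + 2 * (R * t)                  ≤⟨ +-mono-≤ ih (*-monoʳ-≤ 2 block) ⟩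
  2 * ∑ F R + 2 * ∑ (λ i → F (R + i)) R            ≡⟨ *-distribˡ-+ 2 (∑ F R) _ ⟨
  2 * (∑ F R + ∑ (λ i → F (R + i)) R)              ≡⟨ cong (2 *_) (∑-+ F R R) ⟨
  2 * ∑ F (R + R)                                  ≡⟨ cong (λ z → 2 * ∑ F (R + z)) (+-identityʳ R) ⟨
  2 * ∑ F (2 * R)                                  ∎
  where
  open ≤-Reasoning
  R : ℕ
  R = 2 ^ J
  arith : ∀ J R t → suc J * (2 * R * t) ≡ J * (R * (2 * t)) + 2 * (R * t)
  arith = solve-∀
  arith₂ : ∀ R t → 2 * (R * (2 * t)) ≡ 2 * (2 * R * t)
  arith₂ = solve-∀
  arith₃ : ∀ R t → 2 * (R + R) * t ≡ 2 * (2 * R * t)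
  arith₃ = solve-∀
  ih : J * (R * (2 * t)) ≤ 2 * ∑ F R
  -- Halving the range of `e` while doubling `t` leaves the bound on `(1 + 2 * e) * M` unchanged.
  ih = dyadic-sum J (2 * t) F λ e M e<R le →
    h e M (≤-trans e<R (m≤m+n R _)) (≤-trans le (≤-reflexive (arith₂ R t)))
  block : R * t ≤ ∑ (λ i → F (R + i)) R
  block = begin
    R * t                        ≡⟨ ∑-const t R ⟨
    ∑ (λ _ → t) R                ≤⟨ ∑-mono R (λ i i<R → h (R + i) t (R+i< i<R) (below i i<R)) ⟩
    ∑ (λ i → F (R + i)) R        ∎
    where
    R+i< : ∀ {i} → i < R → R + i < 2 * R
    R+i< {i} i<R = subst (R + i <_) (cong (R +_) (sym (+-identityʳ R))) (+-monoʳ-< R i<R)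
    below : ∀ i → i < R → (1 + 2 * (R + i)) * t ≤ 2 * (2 * R * t)
    below i i<R = begin
      (1 + 2 * (R + i)) * t     ≤⟨ *-monoˡ-≤ t (n≤1+n (1 + 2 * (R + i))) ⟩
      (2 + 2 * (R + i)) * t     ≡⟨ cong (_* t) (*-suc 2 (R + i)) ⟨
      2 * suc (R + i) * t       ≤⟨ *-monoˡ-≤ t (*-monoʳ-≤ 2 (+-monoʳ-< R i<R)) ⟩
      2 * (R + R) * t           ≡⟨ arith₃ R t ⟩
      2 * (2 * R * t)           ∎

even⊎odd : ∀ n → (∃[ f ] n ≡ 2 * f) ⊎ (∃[ f ] n ≡ 1 + 2 * f)
even⊎odd zero = inj₁ (0 , refl)
even⊎odd (suc n) with even⊎odd n
... | inj₁ (f , refl) = inj₂ (f , refl)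
... | inj₂ (f , refl) = inj₁ (suc f , sym (*-suc 2 f))

2∤odd : ∀ e → ¬ 2 ∣ 1 + 2 * e
2∤odd e 2∣ = contradiction (∣⇒≤ (∣m+n∣m⇒∣n (subst (2 ∣_) (+-comm 1 (2 * e)) 2∣) (m∣m*n e))) λ { (s≤s ()) }

odd-divisor : ∀ {i} e → i ∣ 1 + 2 * e → ∃[ f ] f ≤ e × i ≡ 1 + 2 * f
odd-divisor {i} e i∣ with even⊎odd i
... | inj₁ (f , refl) = contradiction (∣-trans (m∣m*n f) i∣) (2∤odd e)
... | inj₂ (f , refl) = f , *-cancelˡ-≤ 2 (s≤s⁻¹ (∣⇒≤ i∣)) , refl

-- Telescoping estimates for a recurrence with losses

module Dynamics
  (k : ℕ) (v ℓ : ℕ → ℕ)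
  (step : ∀ n → 2 * v (2 + n) + (ℓ n + ℓ (1 + n)) ≡ v (1 + n) + v n + k)
  (loss : ∀ n e → 1 ≤ e → (1 + 2 * e) ∣ v n → v n ≤ (1 + 2 * e) * ℓ n)
  where

  -- `P` is the invariant of the linear recurrence `2 v″ = v′ + v`; here each step adds `k` to it
  -- and subtracts two losses.
  P D : ℕ → ℕ
  P n = 2 * v (1 + n) + v n
  D n = ∣ v (1 + n) - v n ∣

  P-step : ∀ n → P (1 + n) + (ℓ n + ℓ (1 + n)) ≡ P n + k
  P-step n = begin
    2 * v (2 + n) + v (1 + n) + (ℓ n + ℓ (1 + n))     ≡⟨ arith₁ (2 * v (2 + n)) (v (1 + n)) (ℓ n + ℓ (1 + n)) ⟩
    2 * v (2 + n) + (ℓ n + ℓ (1 + n)) + v (1 + n)     ≡⟨ cong (_+ v (1 + n)) (step n) ⟩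
    v (1 + n) + v n + k + v (1 + n)                   ≡⟨ arith₂ (v (1 + n)) (v n) k ⟩
    2 * v (1 + n) + v n + k                           ∎
    where
    open ≡-Reasoning
    arith₁ : ∀ a b c → a + b + c ≡ a + c + b
    arith₁ = solve-∀
    arith₂ : ∀ a b c → a + b + c + a ≡ 2 * a + b + c
    arith₂ = solve-∀

  -- `P-step` telescopes; of its two losses only `ℓ n` is kept, so that each loss is counted once.
  ∑loss≤ : ∀ n → P n + ∑ ℓ n ≤ P 0 + n * k
  ∑loss≤ zero    = ≤-refl
  ∑loss≤ (suc n) = begin
    P (1 + n) + (∑ ℓ n + ℓ n)                         ≤⟨ m≤m+n _ (ℓ (1 + n)) ⟩
    P (1 + n) + (∑ ℓ n + ℓ n) + ℓ (1 + n)             ≡⟨ arith₁ (P (1 + n)) (∑ ℓ n) (ℓ n) (ℓ (1 + n)) ⟩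
    P (1 + n) + (ℓ n + ℓ (1 + n)) + ∑ ℓ n             ≡⟨ cong (_+ ∑ ℓ n) (P-step n) ⟩
    P n + k + ∑ ℓ n                                   ≡⟨ arith₂ (P n) k (∑ ℓ n) ⟩
    P n + ∑ ℓ n + k                                   ≤⟨ +-monoˡ-≤ k (∑loss≤ n) ⟩
    P 0 + n * k + k                                   ≡⟨ arith₃ (P 0) n k ⟩
    P 0 + suc n * k                                   ∎
    where
    open ≤-Reasoning
    arith₁ : ∀ a b c d → a + (b + c) + d ≡ a + (c + d) + b
    arith₁ = solve-∀
    arith₂ : ∀ a b c → a + b + c ≡ a + c + b
    arith₂ = solve-∀
    arith₃ : ∀ a n k → a + n * k + k ≡ a + (k + n * k)
    arith₃ = solve-∀

  P≤ : ∀ n → P n ≤ P 0 + n * k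
  P≤ n = ≤-trans (m≤m+n (P n) _) (∑loss≤ n)

  v≤ : ∀ n → v n ≤ P 0 + n * k
  v≤ n = ≤-trans (m≤n+m (v n) _) (P≤ n)

  -- The recurrence reads `2 (v″ - v′) = (v - v′) + k - losses`: up to `k` and the losses, the
  -- difference halves in each step.
  D-step : ∀ n → 2 * D (1 + n) ≤ D n + k + (ℓ n + ℓ (1 + n))
  D-step n = begin
    2 * ∣ v (2 + n) - v (1 + n) ∣              ≡⟨ *-distribˡ-∣-∣ 2 (v (2 + n)) (v (1 + n)) ⟩
    ∣ 2 * v (2 + n) - 2 * v (1 + n) ∣          ≤⟨ ∣-∣≤ upper lower ⟩
    D n + k + L                                ∎
    where
    open ≤-Reasoning
    a b L : ℕ
    a = v (1 + n)
    b = v n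
    L = ℓ n + ℓ (1 + n)
    arith₁ : ∀ a d k L → a + (a + d) + k + L ≡ 2 * a + (d + k + L)
    arith₁ = solve-∀
    arith₂ : ∀ a b d → a + (b + d) ≡ a + b + d
    arith₂ = solve-∀
    arith₃ : ∀ w L k d → w + L + d + k ≡ w + (d + k + L)
    arith₃ = solve-∀
    upper : 2 * v (2 + n) ≤ 2 * a + (D n + k + L)
    upper = begin
      2 * v (2 + n)                ≤⟨ m≤m+n _ L ⟩
      2 * v (2 + n) + L            ≡⟨ step n ⟩
      a + b + k                    ≤⟨ +-monoˡ-≤ k (+-monoʳ-≤ a (m≤n+∣n-m∣ b a)) ⟩
      a + (a + D n) + k            ≤⟨ m≤m+n _ L ⟩
      a + (a + D n) + k + L        ≡⟨ arith₁ a (D n) k L ⟩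
      2 * a + (D n + k + L)        ∎
    lower : 2 * a ≤ 2 * v (2 + n) + (D n + k + L)
    lower = begin
      2 * a                            ≡⟨ cong (a +_) (+-identityʳ a) ⟩
      a + a                            ≤⟨ +-monoʳ-≤ a (m≤n+∣m-n∣ a b) ⟩
      a + (b + D n)                    ≡⟨ arith₂ a b (D n) ⟩
      a + b + D n                      ≤⟨ +-monoˡ-≤ (D n) (m≤m+n (a + b) k) ⟩
      a + b + k + D n                  ≡⟨ cong (_+ D n) (step n) ⟨
      2 * v (2 + n) + L + D n          ≤⟨ m≤m+n _ k ⟩
      2 * v (2 + n) + L + D n + k      ≡⟨ arith₃ (2 * v (2 + n)) L k (D n) ⟩
      2 * v (2 + n) + (D n + k + L)    ∎

  D₀≤P₀ : D 0 ≤ P 0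
  D₀≤P₀ = ≤-trans (∣m-n∣≤m⊔n (v 1) (v 0))
    (⊔-lub (≤-trans (m≤m+n (v 1) _) (m≤m+n _ (v 0))) (m≤n+m (v 0) _))

  -- The terms `2 * D n` and `P n` make the induction close: `D-step` trades `2 * D (1 + n)` for
  -- `D n`, one `k` and two losses, and by `P-step` the potential absorbs these losses for another
  -- `k`.
  ∑D≤ : ∀ n → 2 * D n + ∑ D n + P n ≤ 3 * P 0 + n * (2 * k)
  ∑D≤ zero = begin
    2 * D 0 + 0 + P 0      ≤⟨ +-monoˡ-≤ (P 0) (+-monoˡ-≤ 0 (*-monoʳ-≤ 2 D₀≤P₀)) ⟩
    2 * P 0 + 0 + P 0      ≡⟨ arith (P 0) ⟩
    3 * P 0 + 0            ∎
    where
    open ≤-Reasoning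
    arith : ∀ p → 2 * p + 0 + p ≡ 3 * p + 0
    arith = solve-∀
  ∑D≤ (suc n) = begin
    2 * D (1 + n) + (∑ D n + D n) + P (1 + n)       ≤⟨ +-monoˡ-≤ (P (1 + n)) (+-monoˡ-≤ (∑ D n + D n) (D-step n)) ⟩
    D n + k + L + (∑ D n + D n) + P (1 + n)         ≡⟨ arith₁ (D n) k L (∑ D n) (P (1 + n)) ⟩
    2 * D n + ∑ D n + k + (P (1 + n) + L)           ≡⟨ cong (2 * D n + ∑ D n + k +_) (P-step n) ⟩
    2 * D n + ∑ D n + k + (P n + k)                 ≡⟨ arith₂ (2 * D n + ∑ D n) k (P n) ⟩
    2 * D n + ∑ D n + P n + 2 * k                   ≤⟨ +-monoˡ-≤ (2 * k) (∑D≤ n) ⟩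
    3 * P 0 + n * (2 * k) + 2 * k                   ≡⟨ arith₃ (3 * P 0) n (2 * k) ⟩
    3 * P 0 + suc n * (2 * k)                       ∎
    where
    open ≤-Reasoning
    L : ℕ
    L = ℓ n + ℓ (1 + n)
    arith₁ : ∀ d k l s p → d + k + l + (s + d) + p ≡ 2 * d + s + k + (p + l)
    arith₁ = solve-∀
    arith₂ : ∀ a k p → a + k + (p + k) ≡ a + p + 2 * k
    arith₂ = solve-∀
    arith₃ : ∀ a n k → a + n * k + k ≡ a + (k + n * k)
    arith₃ = solve-∀

  -- Counting good times while all states are distinct

  module Counting
    (J t C : ℕ) (C≡ : C ≡ 6 * (1 + k))
    (distinct : ∀ m n → m < 2 * (2 ^ J * t) → n < 2 * (2 ^ J * t) →
                v m ≡ v n → v (1 + m) ≡ v (1 + n) → m ≡ n)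
    where

    -- The multipliers are the odd `1 + 2 * e` with `e < R`, and `N` is the time span. `S` bounds
    -- the number of small times, and `E` is the error in the lower bound for good times.
    R N S E : ℕ
    R = 2 ^ J
    N = 2 * (R * t)
    S = (1 + 2 * R * C) * (2 * C)
    E = 2 * S + 4 * P 0

    -- The signed difference of consecutive values, shifted by `C`. When `D n < C` nothing is
    -- truncated and the result lies below `2 * C`.
    offset : ℕ → ℕ
    offset n = v (1 + n) + C ∸ v n

    v≤v+C : ∀ n → D n < C → v n ≤ v (1 + n) + C
    v≤v+C n D<C = ≤-trans (m≤n+∣n-m∣ (v n) (v (1 + n))) (+-monoʳ-≤ (v (1 + n)) (<⇒≤ D<C))

    offset-+ : ∀ n → D n < C → offset n + v n ≡ v (1 + n) + C
    offset-+ n D<C = m∸n+n≡m (v≤v+C n D<C)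

    offset< : ∀ n → D n < C → offset n < 2 * C
    offset< n D<C = +-cancelʳ-< (v n) (offset n) (2 * C) (begin-strict
      offset n + v n        ≡⟨ offset-+ n D<C ⟩
      v (1 + n) + C         ≤⟨ +-monoˡ-≤ C (m≤n+∣m-n∣ (v (1 + n)) (v n)) ⟩
      v n + D n + C         <⟨ +-monoˡ-< C (+-monoʳ-< (v n) D<C) ⟩
      v n + C + C           ≡⟨ arith (v n) C ⟩
      2 * C + v n           ∎)
      where
      open ≤-Reasoning
      arith : ∀ a c → a + c + c ≡ 2 * c + a
      arith = solve-∀

    same-state : ∀ {m n} → m < N → n < N → D m < C → D n < C → v m ≡ v n → offset m ≡ offset n → m ≡ n
    same-state {m} {n} m<N n<N Dm Dn vm≡vn om≡on = distinct m n m<N n<N vm≡vn (+-cancelʳ-≡ C _ _ (begin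
      v (1 + m) + C      ≡⟨ offset-+ m Dm ⟨
      offset m + v m     ≡⟨ cong₂ _+_ om≡on vm≡vn ⟩
      offset n + v n     ≡⟨ offset-+ n Dn ⟩
      v (1 + n) + C      ∎))
      where open ≡-Reasoning

    -- `Smooth` asks only for one odd divisor `1 < d < 2R`; its negation is roughness. Above the
    -- threshold `2 * R * C` a smooth value forces a loss greater than `C`.
    Smooth Good Small : ℕ → Set
    Smooth m = ∃[ e ] (e < R × 1 ≤ e × (1 + 2 * e) ∣ m)
    Good n   = D n < C × ¬ Smooth (v n)
    Small n  = D n < C × v n ≤ 2 * R * C

    smooth? : ∀ m → Dec (Smooth m)
    smooth? m = anyUpTo? (λ e → 1 ≤? e ×-dec (1 + 2 * e) ∣? m) R

    good? : ∀ n → Dec (Good n)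
    good? n = D n <? C ×-dec ¬? (smooth? (v n))

    small? : ∀ n → Dec (Small n)
    small? n = D n <? C ×-dec v n ≤? 2 * R * C

    1+2e≤2R : ∀ {e} → e < R → 1 + 2 * e ≤ 2 * R
    1+2e≤2R {e} e<R = begin
      1 + 2 * e     ≤⟨ n≤1+n _ ⟩
      2 + 2 * e     ≡⟨ *-suc 2 e ⟨
      2 * suc e     ≤⟨ *-monoʳ-≤ 2 e<R ⟩
      2 * R         ∎
      where open ≤-Reasoning

    good⊎small⊎costly : ∀ n → Good n ⊎ Small n ⊎ C ≤ D n + ℓ n
    good⊎small⊎costly n with D n <? C
    ... | no ¬D<C = inj₂ (inj₂ (≤-trans (≮⇒≥ ¬D<C) (m≤m+n _ _)))
    ... | yes D<C with smooth? (v n)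
    ...   | no ¬s = inj₁ (D<C , ¬s)
    ...   | yes (e , e<R , 1≤e , d∣v) with v n ≤? 2 * R * C
    ...     | yes le = inj₂ (inj₁ (D<C , le))
    ...     | no ¬le = inj₂ (inj₂ (≤-trans (<⇒≤ (*-cancelˡ-< (2 * R) C (ℓ n) (begin-strict
      2 * R * C              <⟨ ≰⇒> ¬le ⟩
      v n                    ≤⟨ loss n e 1≤e d∣v ⟩
      (1 + 2 * e) * ℓ n      ≤⟨ *-monoˡ-≤ (ℓ n) (1+2e≤2R e<R) ⟩
      2 * R * ℓ n            ∎))) (m≤n+m _ _)))
      where open ≤-Reasoning

    -- The three cases as a single inequality, in a form that can be summed over times.
    pointwise : ∀ n → C ≤ C * (𝟙 (good? n) + 𝟙 (small? n)) + (D n + ℓ n)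
    pointwise n with good⊎small⊎costly n
    ... | inj₁ g rewrite 𝟙-true (good? n) g = ≤-trans (m≤m*n C (1 + 𝟙 (small? n))) (m≤m+n _ _)
    ... | inj₂ (inj₁ s) rewrite 𝟙-true (small? n) s | +-comm (𝟙 (good? n)) 1 =
      ≤-trans (m≤m*n C (1 + 𝟙 (good? n))) (m≤m+n _ _)
    ... | inj₂ (inj₂ c) = ≤-trans c (m≤n+m (D n + ℓ n) (C * (𝟙 (good? n) + 𝟙 (small? n))))

    -- By distinctness `v n` and `offset n` determine `n`; at a small time they take at most
    -- `1 + 2 * R * C` and `2 * C` values.
    #small≤S : ∀ {M} → M ≤ N → ∑ (λ n → 𝟙 (small? n)) M ≤ S
    #small≤S {M} M≤N = subst (_≤ S) (length-filter-applyUpTo small? id M)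
      (pigeonhole (filter⁺ small? (upTo⁺ M)) (λ n → v n * (2 * C) + offset n) bounded inj)
      where
      open ≤-Reasoning
      member : ∀ {n} → n ∈ filter small? (upTo M) → n < N × Small n
      member n∈ with ∈-filter⁻ small? n∈
      ... | n∈upTo , s = ≤-trans (∈-upTo⁻ n∈upTo) M≤N , s
      bounded : ∀ {n} → n ∈ filter small? (upTo M) → v n * (2 * C) + offset n < S
      bounded {n} n∈ with member n∈
      ... | _ , D<C , v≤ = begin-strict
        v n * (2 * C) + offset n               <⟨ +-mono-≤-< (*-monoˡ-≤ (2 * C) v≤) (offset< n D<C) ⟩
        2 * R * C * (2 * C) + 2 * C            ≡⟨ +-comm _ (2 * C) ⟩
        S                                      ∎
      inj : ∀ {m n} → m ∈ filter small? (upTo M) → n ∈ filter small? (upTo M) →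
            v m * (2 * C) + offset m ≡ v n * (2 * C) + offset n → m ≡ n
      inj {m} {n} m∈ n∈ eq with member m∈ | member n∈
      ... | m<N , Dm , _ | n<N , Dn , _ =
        uncurry (same-state m<N n<N Dm Dn) (*+-injective (2 * C) (offset< m Dm) (offset< n Dn) eq)

    -- Summing `pointwise` gives `M * C ≤ C * (#good + S) + 4 * P 0 + 3 * k * M`. Since `C = 6 * (1
    -- + k)`, the last term is at most half of the left side; it is added to both sides to avoid a
    -- subtraction.
    M≤2#good+E : ∀ M → M ≤ N → M ≤ 2 * ∑ (λ n → 𝟙 (good? n)) M + E
    M≤2#good+E M M≤N = *-cancelˡ-≤ (3 * (1 + k)) (+-cancelʳ-≤ (3 * k * M) _ _ (begin
      3 * (1 + k) * M + 3 * k * M                       ≤⟨ +-monoʳ-≤ (3 * (1 + k) * M) (*-monoˡ-≤ M (*-monoʳ-≤ 3 (n≤1+n k))) ⟩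
      3 * (1 + k) * M + 3 * (1 + k) * M                 ≡⟨ trans (arith₁ k M) (cong (M *_) (sym C≡)) ⟩
      M * C                                             ≡⟨ ∑-const C M ⟨
      ∑ (λ _ → C) M                                     ≤⟨ ∑-mono M (λ n _ → pointwise n) ⟩
      ∑ (λ n → C * (g n + s n) + (D n + ℓ n)) M         ≡⟨ ∑-distrib-+ (λ n → C * (g n + s n)) (λ n → D n + ℓ n) M ⟩
      ∑ (λ n → C * (g n + s n)) M + ∑ (λ n → D n + ℓ n) M
        ≡⟨ cong₂ _+_ (trans (∑-distribˡ-* C _ M) (cong (C *_) (∑-distrib-+ g s M))) (∑-distrib-+ D ℓ M) ⟩
      C * (∑ g M + ∑ s M) + (∑ D M + ∑ ℓ M)
        ≤⟨ +-mono-≤ (*-monoʳ-≤ C (+-monoʳ-≤ (∑ g M) (#small≤S M≤N)))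
             (+-mono-≤ (≤-trans (≤-trans (m≤n+m (∑ D M) (2 * D M)) (m≤m+n _ (P M))) (∑D≤ M))
                       (≤-trans (m≤n+m (∑ ℓ M) (P M)) (∑loss≤ M))) ⟩
      C * (∑ g M + S) + (3 * P 0 + M * (2 * k) + (P 0 + M * k))
        ≡⟨ trans (cong (λ c → c * (∑ g M + S) + (3 * P 0 + M * (2 * k) + (P 0 + M * k))) C≡)
             (arith₂ k (∑ g M) S (P 0) M) ⟩
      3 * (1 + k) * (2 * ∑ g M + 2 * S) + 4 * P 0 + 3 * k * M
        ≤⟨ +-monoˡ-≤ (3 * k * M) (+-monoʳ-≤ (3 * (1 + k) * (2 * ∑ g M + 2 * S)) (m≤n*m (4 * P 0) (3 * (1 + k)))) ⟩
      3 * (1 + k) * (2 * ∑ g M + 2 * S) + 3 * (1 + k) * (4 * P 0) + 3 * k * M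
        ≡⟨ cong (_+ 3 * k * M) (trans (sym (*-distribˡ-+ (3 * (1 + k)) (2 * ∑ g M + 2 * S) (4 * P 0)))
             (cong (3 * (1 + k) *_) (+-assoc (2 * ∑ g M) (2 * S) (4 * P 0)))) ⟩
      3 * (1 + k) * (2 * ∑ g M + E) + 3 * k * M         ∎))
      where
      open ≤-Reasoning
      g s : ℕ → ℕ
      g n = 𝟙 (good? n)
      s n = 𝟙 (small? n)
      arith₁ : ∀ k M → 3 * (1 + k) * M + 3 * (1 + k) * M ≡ M * (6 * (1 + k))
      arith₁ = solve-∀
      arith₂ : ∀ k g s p M → 6 * (1 + k) * (g + s) + (3 * p + M * (2 * k) + (p + M * k))
                 ≡ 3 * (1 + k) * (2 * g + 2 * s) + 4 * p + 3 * k * M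
      arith₂ = solve-∀

    odd-coprime-rough : ∀ {e m} → e < R → ¬ Smooth m → Coprime (1 + 2 * e) m
    odd-coprime-rough {e} e<R rough (i∣d , i∣m) with odd-divisor e i∣d
    ... | zero  , _   , i≡1 = i≡1
    ... | suc f , f≤e , refl = contradiction (suc f , ≤-<-trans f≤e e<R , s≤s z≤n , i∣m) rough

    -- Each odd factor is coprime to the other rough cofactor, hence divides the other odd factor;
    -- mutual divisibility makes the two equal.
    odd-multiples-of-rough : ∀ {e m e′ m′} → e < R → e′ < R → ¬ Smooth m → ¬ Smooth m′ →
                             (1 + 2 * e) * m ≡ (1 + 2 * e′) * m′ → e ≡ e′ × m ≡ m′
    odd-multiples-of-rough {e} {m} {e′} {m′} e<R e′<R rough rough′ eq = e≡e′ , m≡m′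
      where
      d∣d′ : (1 + 2 * e) ∣ (1 + 2 * e′)
      d∣d′ = coprime-divisor (odd-coprime-rough e<R rough′)
        (subst ((1 + 2 * e) ∣_) (trans eq (*-comm _ m′)) (m∣m*n m))
      d′∣d : (1 + 2 * e′) ∣ (1 + 2 * e)
      d′∣d = coprime-divisor (odd-coprime-rough e′<R rough)
        (subst ((1 + 2 * e′) ∣_) (trans (sym eq) (*-comm _ m)) (m∣m*n m′))
      e≡e′ : e ≡ e′
      e≡e′ = *-cancelˡ-≡ e e′ 2 (suc-injective (∣-antisym d∣d′ d′∣d))
      m≡m′ : m ≡ m′
      m≡m′ = *-cancelˡ-≡ m m′ (1 + 2 * e) (trans eq (cong (λ z → (1 + 2 * z) * m′) (sym e≡e′)))

    -- Since `v n ≤ P 0 + n * k`, the restriction on `n` keeps `(1 + 2 * e) * v n` below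
    -- `2 * R * P 0 + N * k`, whose main term `N * k` is the same for all `e`.
    Hit : ℕ × ℕ → Set
    Hit (e , n) = (1 + 2 * e) * n ≤ N × Good n

    hit? : ∀ p → Dec (Hit p)
    hit? (e , n) = (1 + 2 * e) * n ≤? N ×-dec good? n

    H : ℕ → ℕ
    H e = ∑ (λ n → 𝟙 (hit? (e , n))) N

    -- The code reveals `(1 + 2 * e) * v n` and the offset. The product yields `e` and `v n` because
    -- good values are rough, and the state then determines the time.
    #hits≤ : ∑ H R ≤ (1 + (2 * R * P 0 + N * k)) * (2 * C)
    #hits≤ = subst (_≤ (1 + (2 * R * P 0 + N * k)) * (2 * C)) (length-filter-grid hit? id R N)
      (pigeonhole (filter⁺ hit? (cartesianProduct⁺ (upTo⁺ R) (upTo⁺ N))) code bounded inj)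
      where
      open ≤-Reasoning
      code : ℕ × ℕ → ℕ
      code (e , n) = (1 + 2 * e) * v n * (2 * C) + offset n
      hits : List (ℕ × ℕ)
      hits = filter hit? (cartesianProduct (upTo R) (upTo N))
      member : ∀ {e n} → (e , n) ∈ hits → e < R × n < N × Hit (e , n)
      member p∈ with ∈-filter⁻ hit? {xs = cartesianProduct (upTo R) (upTo N)} p∈
      ... | p∈grid , h with ∈-cartesianProduct⁻ (upTo R) (upTo N) p∈grid
      ...   | e∈ , n∈ = ∈-upTo⁻ e∈ , ∈-upTo⁻ n∈ , h
      bounded : ∀ {p} → p ∈ hits → code p < (1 + (2 * R * P 0 + N * k)) * (2 * C)
      bounded {e , n} p∈ with member p∈
      ... | e<R , _ , dn≤N , D<C , _ = begin-strict
        d * v n * (2 * C) + offset n                   <⟨ +-mono-≤-< (*-monoˡ-≤ (2 * C) dv≤) (offset< n D<C) ⟩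
        (2 * R * P 0 + N * k) * (2 * C) + 2 * C        ≡⟨ +-comm _ (2 * C) ⟩
        (1 + (2 * R * P 0 + N * k)) * (2 * C)          ∎
        where
        d : ℕ
        d = 1 + 2 * e
        dv≤ : d * v n ≤ 2 * R * P 0 + N * k
        dv≤ = begin
          d * v n                       ≤⟨ *-monoʳ-≤ d (v≤ n) ⟩
          d * (P 0 + n * k)             ≡⟨ trans (*-distribˡ-+ d (P 0) (n * k)) (cong (d * P 0 +_) (sym (*-assoc d n k))) ⟩
          d * P 0 + d * n * k           ≤⟨ +-mono-≤ (*-monoˡ-≤ (P 0) (1+2e≤2R e<R)) (*-monoˡ-≤ k dn≤N) ⟩
          2 * R * P 0 + N * k           ∎
      inj : ∀ {p q} → p ∈ hits → q ∈ hits → code p ≡ code q → p ≡ q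
      inj {e , n} {e′ , n′} p∈ q∈ eq with member p∈ | member q∈
      ... | e<R , n<N , _ , D<C , rough | e′<R , n′<N , _ , D′<C , rough′
        with *+-injective (2 * C) {(1 + 2 * e) * v n} (offset< n D<C) (offset< n′ D′<C) eq
      ... | dv≡ , o≡ with odd-multiples-of-rough e<R e′<R rough rough′ dv≡
      ...   | refl , v≡ = cong (e ,_) (same-state n<N n′<N D<C D′<C v≡ o≡)

    -- All good times below `M` are hits for `e`; this is the hypothesis that `dyadic-sum` needs.
    M≤2H+E : ∀ e M → e < R → (1 + 2 * e) * M ≤ N → M ≤ 2 * H e + E
    M≤2H+E e M e<R dM≤N = ≤-trans (M≤2#good+E M M≤N) (+-monoˡ-≤ E (*-monoʳ-≤ 2
      (∑-mono-prefix M≤N λ n n<M → 𝟙-mono (good? n) (hit? (e , n)) λ g →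
        ≤-trans (*-monoʳ-≤ (1 + 2 * e) (<⇒≤ n<M)) dM≤N , g)))
      where
      M≤N : M ≤ N
      M≤N = ≤-trans (m≤n*m M (1 + 2 * e)) dM≤N

    -- The divergent lower bound of `dyadic-sum` meets `#hits≤`. After `R` is cancelled, the
    -- coefficient `16 * C * k` is free of `J` and the remainder is free of `t`, so choosing first
    -- `J` and then `t` large violates the inequality.
    Jt≤ : J * t ≤ 16 * C * k * t + (8 * C * (2 * P 0 + 1) + 2 * E)
    Jt≤ = *-cancelˡ-≤ R (begin
      R * (J * t)                                                ≡⟨ arith₁ R J t ⟩
      J * (R * t)                                                ≤⟨ dyadic-sum J t (λ e → 2 * H e + E) M≤2H+E ⟩
      2 * ∑ (λ e → 2 * H e + E) R
        ≡⟨ cong (2 *_) (trans (∑-distrib-+ (λ e → 2 * H e) (λ _ → E) R) (cong₂ _+_ (∑-distribˡ-* 2 H R) (∑-const E R))) ⟩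
      2 * (2 * ∑ H R + R * E)                                    ≤⟨ *-monoʳ-≤ 2 (+-monoˡ-≤ (R * E) (*-monoʳ-≤ 2 #hits≤)) ⟩
      2 * (2 * ((1 + (2 * R * P 0 + N * k)) * (2 * C)) + R * E)
        -- The summand `1` is enlarged to `R`, so that `R` becomes a common factor.
        ≤⟨ *-monoʳ-≤ 2 (+-monoˡ-≤ (R * E) (*-monoʳ-≤ 2 (*-monoˡ-≤ (2 * C) (+-monoˡ-≤ (2 * R * P 0 + N * k) (m^n>0 2 J))))) ⟩
      2 * (2 * ((R + (2 * R * P 0 + N * k)) * (2 * C)) + R * E)  ≡⟨ arith₂ R (P 0) t k C E ⟩
      R * (16 * C * k * t + (8 * C * (2 * P 0 + 1) + 2 * E))     ∎)
      where
      open ≤-Reasoning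
      instance
        R≢0 : NonZero R
        R≢0 = m^n≢0 2 J
      arith₁ : ∀ R J t → R * (J * t) ≡ J * (R * t)
      arith₁ = solve-∀
      arith₂ : ∀ R p t k C E → 2 * (2 * ((R + (2 * R * p + 2 * (R * t) * k)) * (2 * C)) + R * E)
                 ≡ R * (16 * C * k * t + (8 * C * (2 * p + 1) + 2 * E))
      arith₂ = solve-∀

  -- With `J = 1 + a` and `t = 1 + b`, the product `J * t` exceeds `a * t + b` by exactly one.
  not-distinct : ∀ {J t C N} → C ≡ 6 * (1 + k) → J ≡ 1 + 16 * C * k →
                 t ≡ 1 + (8 * C * (2 * P 0 + 1) + 2 * (2 * ((1 + 2 * 2 ^ J * C) * (2 * C)) + 4 * P 0)) →
                 N ≡ 2 * (2 ^ J * t) →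
                 ¬ (∀ m n → m < N → n < N → v m ≡ v n → v (1 + m) ≡ v (1 + n) → m ≡ n)
  not-distinct {J} {t} {C} C≡ J≡ t≡ refl distinct = exceeds J≡ t≡ (Counting.Jt≤ J t C C≡ distinct)
    where
    exceeds : ∀ {J t a b} → J ≡ 1 + a → t ≡ 1 + b → ¬ J * t ≤ a * t + b
    exceeds {a = a} {b} refl refl le = <⇒≱ (≤-reflexive (arith a b)) le
      where
      arith : ∀ a b → suc (a * suc b + b) ≡ suc b + a * suc b
      arith = solve-∀

-- Explicit bounds

n<2^n : ∀ n → n < 2 ^ n
n<2^n zero    = ≤-refl
n<2^n (suc n) = begin-strict
  suc n              <⟨ s≤s (n<2^n n) ⟩
  1 + 2 ^ n          ≤⟨ +-monoˡ-≤ (2 ^ n) (m^n>0 2 n) ⟩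
  2 ^ n + 2 ^ n      ≡⟨ cong (2 ^ n +_) (+-identityʳ (2 ^ n)) ⟨
  2 ^ suc n          ∎
  where open ≤-Reasoning

-- gap is chosen so that at most about half of the times n satisfy gap k ≤ D n + ℓ n; cutoff and
-- width are then the values of J and t that contradict Counting.Jt≤.
gap cutoff : ℕ → ℕ
gap k    = 6 * (1 + k)
cutoff k = 1 + 16 * gap k * k

width : ℕ → ℕ → ℕ
width k p = 1 + (8 * gap k * (2 * p + 1) + 2 * (2 * ((1 + 2 * 2 ^ cutoff k * gap k) * (2 * gap k)) + 4 * p))

horizon : ℕ → ℕ → ℕ
horizon k p = 2 * (2 ^ cutoff k * width k p)

-- The left side is the eventual bound on the sequence. With `q = R * (W * W)` the width is at most
-- `1817 * q`, which gives `7290 * (R * q * W)` in total; `2 ^ 13` rounds the constant up to a power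
-- of two.
horizon≤ : ∀ k p W → 1 + k ≤ W → p ≤ 11 * W →
           22 * W + 2 * (horizon k p * k) ≤ 2 ^ 13 * (2 ^ cutoff k * (2 ^ cutoff k * (W * W)) * W)
horizon≤ k p W k<W p≤ = begin
  22 * W + 2 * (2 * (R * width k p) * k)            ≤⟨ +-mono-≤ (*-monoʳ-≤ 22 W≤) (*-monoʳ-≤ 2 (*-mono-≤ (*-monoʳ-≤ 2 (*-monoʳ-≤ R t≤)) (<⇒≤ k<W))) ⟩
  22 * (R * q * W) + 2 * (2 * (R * (1817 * q)) * W) ≡⟨ arith₁ R q W ⟩
  7290 * (R * q * W)                                ≤⟨ *-monoˡ-≤ (R * q * W) {7290} {2 ^ 13} (≤ᵇ⇒≤ 7290 (2 ^ 13) _) ⟩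
  2 ^ 13 * (R * q * W)                              ∎
  where
  open ≤-Reasoning
  R q C : ℕ
  R = 2 ^ cutoff k
  q = R * (W * W)
  C = 6 * (1 + k)
  instance
    R≢0 : NonZero R
    R≢0 = m^n≢0 2 (cutoff k)
    W≢0 : NonZero W
    W≢0 = >-nonZero (≤-trans (s≤s z≤n) k<W)
    q≢0 : NonZero q
    q≢0 = m*n≢0 R (W * W) {{R≢0}} {{m*n≢0 W W}}
    Rq≢0 : NonZero (R * q)
    Rq≢0 = m*n≢0 R q
    RW≢0 : NonZero (R * W)
    RW≢0 = m*n≢0 R W
  arith₁ : ∀ R q W → 22 * (R * q * W) + 2 * (2 * (R * (1817 * q)) * W) ≡ 7290 * (R * q * W)
  arith₁ = solve-∀
  arith₂ : ∀ R W → (R * W + 2 * R * (6 * W)) * (2 * (6 * W)) ≡ 156 * (R * (W * W))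
  arith₂ = solve-∀
  arith₃ : ∀ q → 2 * (156 * q) + 4 * (11 * q) ≡ 356 * q
  arith₃ = solve-∀
  arith₄ : ∀ W → 8 * (6 * W) * (2 * (11 * W) + W) ≡ 1104 * (W * W)
  arith₄ = solve-∀
  arith₅ : ∀ q → q + (1104 * q + 2 * (356 * q)) ≡ 1817 * q
  arith₅ = solve-∀
  W≤ : W ≤ R * q * W
  W≤ = m≤n*m W (R * q)
  WW≤q : W * W ≤ q
  WW≤q = m≤n*m (W * W) R
  W≤q : W ≤ q
  W≤q = ≤-trans (m≤m*n W W) WW≤q
  C≤ : C ≤ 6 * W
  C≤ = *-monoʳ-≤ 6 k<W
  S≤ : (1 + 2 * R * C) * (2 * C) ≤ 156 * q
  S≤ = begin
    (1 + 2 * R * C) * (2 * C)                       ≤⟨ *-mono-≤ (+-mono-≤ (>-nonZero⁻¹ (R * W)) (*-monoʳ-≤ (2 * R) C≤)) (*-monoʳ-≤ 2 C≤) ⟩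
    (R * W + 2 * R * (6 * W)) * (2 * (6 * W))       ≡⟨ arith₂ R W ⟩
    156 * q                                         ∎
  E≤ : 2 * ((1 + 2 * R * C) * (2 * C)) + 4 * p ≤ 356 * q
  E≤ = begin
    2 * ((1 + 2 * R * C) * (2 * C)) + 4 * p         ≤⟨ +-mono-≤ (*-monoʳ-≤ 2 S≤) (*-monoʳ-≤ 4 (≤-trans p≤ (*-monoʳ-≤ 11 W≤q))) ⟩
    2 * (156 * q) + 4 * (11 * q)                    ≡⟨ arith₃ q ⟩
    356 * q                                         ∎
  t≤ : width k p ≤ 1817 * q
  t≤ = begin
    width k p                                       ≤⟨ +-mono-≤ (>-nonZero⁻¹ q) (+-mono-≤ (*-mono-≤ (*-monoʳ-≤ 8 C≤) (+-mono-≤ (*-monoʳ-≤ 2 p≤) (>-nonZero⁻¹ W))) (*-monoʳ-≤ 2 E≤)) ⟩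
    q + (8 * (6 * W) * (2 * (11 * W) + W) + 2 * (356 * q))   ≡⟨ cong (λ z → q + (z + 2 * (356 * q))) (arith₄ W) ⟩
    q + (1104 * (W * W) + 2 * (356 * q))            ≤⟨ +-monoʳ-≤ q (+-monoˡ-≤ (2 * (356 * q)) (*-monoʳ-≤ 1104 WW≤q)) ⟩
    q + (1104 * q + 2 * (356 * q))                  ≡⟨ arith₅ q ⟩
    1817 * q                                        ∎

4^n≡2^2n : ∀ n → 4 ^ n ≡ 2 ^ (2 * n)
4^n≡2^2n n = ^-*-assoc 2 2 n

cutoff≤ : ∀ k W → 1 + k ≤ W → cutoff k ≤ 96 * (W * W)
cutoff≤ k W 1+k≤W = begin
  cutoff k                                     ≡⟨ cong (λ z → 1 + z * k) (sym (*-assoc 16 6 (1 + k))) ⟩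
  1 + 96 * (1 + k) * k                         ≤⟨ +-monoˡ-≤ (96 * (1 + k) * k) (>-nonZero⁻¹ (96 * (1 + k))) ⟩
  96 * (1 + k) + 96 * (1 + k) * k              ≡⟨ *-suc (96 * (1 + k)) k ⟨
  96 * (1 + k) * (1 + k)                       ≤⟨ *-mono-≤ (*-monoʳ-≤ 96 1+k≤W) 1+k≤W ⟩
  96 * W * W                                   ≡⟨ *-assoc 96 W W ⟩
  96 * (W * W)                                 ∎
  where open ≤-Reasoning

collect-powers : ∀ i j W → 2 ^ i * (2 ^ j * (2 ^ j * (2 ^ W * 2 ^ W)) * 2 ^ W) ≡ 2 ^ (i + (j + (j + (W + W)) + W))
collect-powers i j W = sym (begin
  2 ^ (i + (j + (j + (W + W)) + W))               ≡⟨ ^-distribˡ-+-* 2 i _ ⟩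
  2 ^ i * 2 ^ (j + (j + (W + W)) + W)             ≡⟨ cong (2 ^ i *_) (^-distribˡ-+-* 2 (j + (j + (W + W))) W) ⟩
  2 ^ i * (2 ^ (j + (j + (W + W))) * 2 ^ W)       ≡⟨ cong (λ z → 2 ^ i * (z * 2 ^ W)) (^-distribˡ-+-* 2 j _) ⟩
  2 ^ i * (2 ^ j * 2 ^ (j + (W + W)) * 2 ^ W)     ≡⟨ cong (λ z → 2 ^ i * (2 ^ j * z * 2 ^ W)) (^-distribˡ-+-* 2 j _) ⟩
  2 ^ i * (2 ^ j * (2 ^ j * 2 ^ (W + W)) * 2 ^ W) ≡⟨ cong (λ z → 2 ^ i * (2 ^ j * (2 ^ j * z) * 2 ^ W)) (^-distribˡ-+-* 2 W W) ⟩
  2 ^ i * (2 ^ j * (2 ^ j * (2 ^ W * 2 ^ W)) * 2 ^ W) ∎)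
  where open ≡-Reasoning

-- All terms are at most multiples of `W * W`, 208 of it in total, and `2 * W ^ 7 ≥ 2 * 3 ^ 7`
-- exceeds 208.
exponent≤ : ∀ W → 3 ≤ W → 13 + (96 * (W * W) + (96 * (W * W) + (W + W)) + W) ≤ 2 * W ^ 9
exponent≤ W 3≤W = begin
  13 + (j + (j + (W + W)) + W)
    ≤⟨ +-mono-≤ (m≤m*n 13 q {{m*n≢0 W W}}) (+-mono-≤ (+-monoʳ-≤ j (+-monoʳ-≤ j (+-mono-≤ (m≤m*n W W) (m≤m*n W W)))) (m≤m*n W W)) ⟩
  13 * q + (j + (j + (q + q)) + q)    ≡⟨ arith q ⟩
  208 * q                             ≤⟨ *-monoˡ-≤ q {208} {2 * 3 ^ 7} (≤ᵇ⇒≤ 208 (2 * 3 ^ 7) _) ⟩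
  2 * 3 ^ 7 * q                       ≤⟨ *-monoˡ-≤ q {2 * 3 ^ 7} {2 * W ^ 7} (*-monoʳ-≤ 2 (^-monoˡ-≤ 7 3≤W)) ⟩
  2 * W ^ 7 * q                       ≡⟨ cong (λ z → 2 * W ^ 7 * (W * z)) (*-identityʳ W) ⟨
  2 * W ^ 7 * W ^ 2                   ≡⟨ *-assoc 2 (W ^ 7) (W ^ 2) ⟩
  2 * (W ^ 7 * W ^ 2)                 ≡⟨ cong (2 *_) (^-distribˡ-+-* W 7 2) ⟨
  2 * W ^ 9                           ∎
  where
  open ≤-Reasoning
  q j : ℕ
  q = W * W
  j = 96 * q
  instance
    W≢0 : NonZero W
    W≢0 = >-nonZero (≤-trans (s≤s z≤n) 3≤W)
  arith : ∀ q → 13 * q + (96 * q + (96 * q + (q + q)) + q) ≡ 208 * q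
  arith = solve-∀

-- For `k = 0` the horizon is multiplied by zero, and `22 * W` fits below `4 ^ (W ^ 3)`. For `k ≥ 1`
-- both `3 ^ (k + 1) ≥ 9` and `W ≥ 3` hold, and `W ^ 9` suffices.
horizon≤4^ : ∀ k p W → 2 + k ≤ W → p ≤ 11 * W →
             22 * W + 2 * (horizon k p * k) ≤ 4 ^ (W ^ (3 ^ (k + 1)))
horizon≤4^ zero p W 2≤W p≤ = begin
  22 * W + 2 * (horizon 0 p * 0)      ≡⟨ cong (λ z → 22 * W + 2 * z) (*-zeroʳ (horizon 0 p)) ⟩
  22 * W + 0                          ≡⟨ +-identityʳ (22 * W) ⟩
  22 * W                              ≤⟨ *-mono-≤ (≤ᵇ⇒≤ 22 (2 ^ 5) _) (<⇒≤ (n<2^n W)) ⟩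
  2 ^ 5 * 2 ^ W                       ≡⟨ ^-distribˡ-+-* 2 5 W ⟨
  2 ^ (5 + W)                         ≤⟨ ^-monoʳ-≤ 2 exponent ⟩
  2 ^ (2 * W ^ 3)                     ≡⟨ 4^n≡2^2n (W ^ 3) ⟨
  4 ^ (W ^ 3)                         ∎
  where
  open ≤-Reasoning
  instance
    W≢0 : NonZero W
    W≢0 = >-nonZero (≤-trans (s≤s z≤n) 2≤W)
  exponent : 5 + W ≤ 2 * W ^ 3
  exponent = begin
    5 + W                ≤⟨ +-monoˡ-≤ W (m≤m*n 5 W) ⟩
    5 * W + W            ≡⟨ arith W ⟩
    6 * W                ≤⟨ *-monoˡ-≤ W (≤ᵇ⇒≤ 6 8 _) ⟩
    2 * 4 * W            ≤⟨ *-monoˡ-≤ W (*-monoʳ-≤ 2 (^-monoˡ-≤ 2 2≤W)) ⟩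
    2 * W ^ 2 * W        ≡⟨ arith₂ W ⟩
    2 * W ^ 3            ∎
    where
    arith : ∀ W → 5 * W + W ≡ 6 * W
    arith = solve-∀
    arith₂ : ∀ W → 2 * (W * (W * 1)) * W ≡ 2 * (W * (W * (W * 1)))
    arith₂ = solve-∀
horizon≤4^ k@(suc k′) p W 2+k≤W p≤ = begin
  22 * W + 2 * (horizon k p * k)                 ≤⟨ horizon≤ k p W (<⇒≤ 2+k≤W) p≤ ⟩
  2 ^ 13 * (R * (R * (W * W)) * W)
    ≤⟨ *-monoʳ-≤ (2 ^ 13) (*-mono-≤ (*-mono-≤ R≤ (*-mono-≤ R≤ (*-mono-≤ W≤ W≤))) W≤) ⟩
  2 ^ 13 * (2 ^ j * (2 ^ j * (2 ^ W * 2 ^ W)) * 2 ^ W)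
    ≡⟨ collect-powers 13 j W ⟩
  2 ^ (13 + (j + (j + (W + W)) + W))             ≤⟨ ^-monoʳ-≤ 2 (exponent≤ W 3≤W) ⟩
  2 ^ (2 * W ^ 9)                                ≡⟨ 4^n≡2^2n (W ^ 9) ⟨
  4 ^ (W ^ 9)                                    ≤⟨ ^-monoʳ-≤ 4 (^-monoʳ-≤ W 9≤) ⟩
  4 ^ (W ^ (3 ^ (k + 1)))                        ∎
  where
  open ≤-Reasoning
  R j : ℕ
  R = 2 ^ cutoff k
  j = 96 * (W * W)
  3≤W : 3 ≤ W
  3≤W = ≤-trans (s≤s (s≤s (s≤s z≤n))) 2+k≤W
  instance
    W≢0 : NonZero W
    W≢0 = >-nonZero (≤-trans (s≤s z≤n) 2+k≤W)
  9≤ : 3 ^ 2 ≤ 3 ^ (k + 1)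
  9≤ = ^-monoʳ-≤ 3 (+-monoˡ-≤ 1 (s≤s (z≤n {k′})))
  W≤ : W ≤ 2 ^ W
  W≤ = <⇒≤ (n<2^n W)
  R≤ : R ≤ 2 ^ j
  R≤ = ^-monoʳ-≤ 2 (cutoff≤ k W (<⇒≤ 2+k≤W))

^-distribʳ-* : ∀ Q a b → (a * b) ^ Q ≡ a ^ Q * b ^ Q
^-distribʳ-* zero    a b = refl
^-distribʳ-* (suc Q) a b rewrite ^-distribʳ-* Q a b = *-interchange a b (a ^ Q) (b ^ Q)
  where
  *-interchange : ∀ a b c d → a * b * (c * d) ≡ a * c * (b * d)
  *-interchange = solve-∀

-- The base `X = B / 2` of the theorem may be a half-integer. Raising to the power `2 ^ Q` turns
-- `y ≤ 4 ^ (X ^ Q)` into an equivalent inequality of naturals, for which `W ≤ X` is enough.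
power-bound : ∀ Q W B y → 2 * W ≤ B → y ≤ 4 ^ (W ^ Q) → y ^ (2 ^ Q) ≤ 4 ^ (B ^ Q)
power-bound Q W B y 2W≤B y≤ = begin
  y ^ (2 ^ Q)                   ≤⟨ ^-monoˡ-≤ (2 ^ Q) y≤ ⟩
  (4 ^ (W ^ Q)) ^ (2 ^ Q)       ≡⟨ ^-*-assoc 4 (W ^ Q) (2 ^ Q) ⟩
  4 ^ (W ^ Q * 2 ^ Q)           ≡⟨ cong (4 ^_) (trans (*-comm (W ^ Q) _) (sym (^-distribʳ-* Q 2 W))) ⟩
  4 ^ ((2 * W) ^ Q)             ≤⟨ ^-monoʳ-≤ 4 (^-monoˡ-≤ Q 2W≤B) ⟩
  4 ^ (B ^ Q)                   ∎
  where open ≤-Reasoning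

-- The totient recurrence

module Parity
  (k : ℕ) (k-even : 2 ∣ k) (u : ℕ → ℕ) (1≤u₀ : 1 ≤ u 0) (1≤u₁ : 1 ≤ u 1)
  (rec : ∀ n → u (2 + n) ≡ φ (u (1 + n)) + φ (u n) + k)
  where

  u≥1 : ∀ n → 1 ≤ u n
  u≥1 zero          = 1≤u₀
  u≥1 (suc zero)    = 1≤u₁
  u≥1 (suc (suc n)) = subst (1 ≤_) (sym (rec n))
    (≤-trans (φ-positive _ (u≥1 (suc n))) (≤-trans (m≤m+n _ (φ (u n))) (m≤m+n _ k)))

  -- From 3 on, totients are even and positive, hence at least 2, so terms of size at least 3
  -- persist. If `u 2 ≤ 2`, then both initial totients are 1 and `k` is 0, and the sequence stays at
  -- 2.
  u-tail : (∀ n → u (2 + n) ≡ 2) ⊎ (∀ n → 3 ≤ u (2 + n))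
  u-tail with 3 ≤? u 2
  ... | yes 3≤u₂ = inj₂ large
    where
    2≤φ : ∀ m → 3 ≤ m → 2 ≤ φ m
    2≤φ m 3≤m = ∣⇒≤ {{>-nonZero (φ-positive m (≤-trans (s≤s z≤n) 3≤m))}} (φ-even m 3≤m)
    large : ∀ n → 3 ≤ u (2 + n)
    large zero    = 3≤u₂
    large (suc n) = subst (3 ≤_) (sym (rec (suc n)))
      (≤-trans (+-mono-≤ (2≤φ _ (large n)) (φ-positive _ (u≥1 (suc n)))) (m≤m+n _ k))
  ... | no ¬3≤u₂ = inj₁ (λ n → proj₁ (constant n))
    where
    sum≤2 : φ (u 1) + φ (u 0) + k ≤ 2
    sum≤2 = subst (_≤ 2) (rec 0) (s≤s⁻¹ (≰⇒> ¬3≤u₂))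
    1≤φ₀ : 1 ≤ φ (u 0)
    1≤φ₀ = φ-positive _ 1≤u₀
    1≤φ₁ : 1 ≤ φ (u 1)
    1≤φ₁ = φ-positive _ 1≤u₁
    φ₁≡1 : φ (u 1) ≡ 1
    φ₁≡1 = ≤-antisym (+-cancelʳ-≤ 1 _ 1 (≤-trans (+-monoʳ-≤ (φ (u 1)) 1≤φ₀) (≤-trans (m≤m+n _ k) sum≤2))) 1≤φ₁
    k≡0 : k ≡ 0
    k≡0 = n≤0⇒n≡0 (+-cancelˡ-≤ 2 k 0 (≤-trans (+-monoˡ-≤ k (+-mono-≤ 1≤φ₁ 1≤φ₀)) sum≤2))
    -- The term `u 1` may be 1 or 2, so the induction carries its totient instead of its value.
    constant : ∀ n → u (2 + n) ≡ 2 × φ (u (1 + n)) ≡ 1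
    constant zero    = ≤-antisym (subst (_≤ 2) (sym (rec 0)) sum≤2)
      (subst (2 ≤_) (sym (rec 0)) (≤-trans (+-mono-≤ 1≤φ₁ 1≤φ₀) (m≤m+n _ k))) , φ₁≡1
    constant (suc n) with constant n
    ... | u≡2 , φ≡1 = trans (rec (suc n)) (trans (cong₂ _+_ (cong₂ _+_ (cong φ u≡2) φ≡1) k≡0) refl) , cong φ u≡2

  u-even : ∀ n → 2 ∣ u (4 + n)
  u-even n with u-tail
  ... | inj₁ ≡2 = subst (2 ∣_) (sym (≡2 (2 + n))) ∣-refl
  ... | inj₂ 3≤ = subst (2 ∣_) (sym (rec (2 + n)))
    (∣m∣n⇒∣m+n (∣m∣n⇒∣m+n (φ-even _ (3≤ (1 + n))) (φ-even _ (3≤ n))) k-even)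

module TotientSequence
  (k : ℕ) (u v : ℕ → ℕ) (1≤u₀ : 1 ≤ u 0) (1≤u₁ : 1 ≤ u 1)
  (rec : ∀ n → u (2 + n) ≡ φ (u (1 + n)) + φ (u n) + k)
  (u≡2v : ∀ n → u (4 + n) ≡ 2 * v n)
  where

  open ≤-Reasoning

  W : ℕ
  W = u 0 + u 1 + k

  2+k≤W : 2 + k ≤ W
  2+k≤W = +-monoˡ-≤ k (+-mono-≤ 1≤u₀ 1≤u₁)

  ℓ : ℕ → ℕ
  ℓ n = v n ∸ φ (2 * v n)

  φ+ℓ : ∀ n → φ (u (4 + n)) + ℓ n ≡ v n
  φ+ℓ n = trans (cong (λ z → φ z + ℓ n) (u≡2v n)) (m+[n∸m]≡n (φ-double-≤ (v n)))

  step : ∀ n → 2 * v (2 + n) + (ℓ n + ℓ (1 + n)) ≡ v (1 + n) + v n + k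
  step n = begin-equality
    2 * v (2 + n) + (ℓ n + ℓ (1 + n))            ≡⟨ cong (_+ (ℓ n + ℓ (1 + n))) (trans (sym (u≡2v (2 + n))) (rec (4 + n))) ⟩
    a + b + k + (ℓ n + ℓ (1 + n))                ≡⟨ arith a b k (ℓ n) (ℓ (1 + n)) ⟩
    (a + ℓ (1 + n)) + (b + ℓ n) + k              ≡⟨ cong (_+ k) (cong₂ _+_ (φ+ℓ (1 + n)) (φ+ℓ n)) ⟩
    v (1 + n) + v n + k                          ∎
    where
    a b : ℕ
    a = φ (u (5 + n))
    b = φ (u (4 + n))
    arith : ∀ a b k l l′ → a + b + k + (l + l′) ≡ a + l′ + (b + l) + k
    arith = solve-∀

  open Dynamics k v ℓ step (λ n e → φ-double-loss e (v n)) using (P; v≤; not-distinct)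

  -- Repetition of a state and periodicity

  Repetition : ℕ → Set
  Repetition N = ∃[ n ] (n < N × ∃[ m ] (m < n × v m ≡ v n × v (1 + m) ≡ v (1 + n)))

  repetition? : ∀ N → Dec (Repetition N)
  repetition? = anyUpTo? (λ n → anyUpTo? (λ m → v m ≟ v n ×-dec v (1 + m) ≟ v (1 + n)) n)

  ¬repetition⇒distinct : ∀ {N} → ¬ Repetition N →
                         ∀ m n → m < N → n < N → v m ≡ v n → v (1 + m) ≡ v (1 + n) → m ≡ n
  ¬repetition⇒distinct ¬r m n m<N n<N p q with <-cmp m n
  ... | tri< m<n _ _ = contradiction (n , n<N , m , m<n , p , q) ¬r
  ... | tri≈ _ m≡n _ = m≡n
  ... | tri> _ _ n<m = contradiction (m , m<N , n , n<m , sym p , sym q) ¬r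

  -- Repetition below a bound is decidable by finite search, so refuting its absence produces one.
  repetition : Repetition (horizon k (P 0))
  repetition = decidable-stable (repetition? (horizon k (P 0)))
    λ ¬r → not-distinct {cutoff k} {width k (P 0)} {gap k} refl refl refl refl (¬repetition⇒distinct ¬r)

  -- The recurrence has order two, so two consecutive equalities propagate together.
  shift : ∀ {a b} → u a ≡ u b → u (1 + a) ≡ u (1 + b) → ∀ i → u (i + a) ≡ u (i + b) × u (1 + i + a) ≡ u (1 + i + b)
  shift p q zero    = p , q
  shift {a} {b} p q (suc i) with shift p q i
  ... | p′ , q′ = q′ , trans (rec (i + a)) (trans (cong (_+ k) (cong₂ _+_ (cong φ q′) (cong φ p′))) (sym (rec (i + b))))

  same-tail : ∀ {m n} → v m ≡ v n → v (1 + m) ≡ v (1 + n) → ∀ i → u (i + (4 + m)) ≡ u (i + (4 + n))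
  same-tail {m} {n} p q i = proj₁ (shift (lift m n p) (lift (1 + m) (1 + n) q) i)
    where
    lift : ∀ a b → v a ≡ v b → u (4 + a) ≡ u (4 + b)
    lift a b eq = trans (u≡2v a) (trans (cong (2 *_) eq) (sym (u≡2v b)))

  repetition⇒periodic : ∀ {N} → Repetition N → ∃[ T ] (1 ≤ T × ∃[ A ] (∀ n → A ≤ n → u (T + n) ≡ u n))
  repetition⇒periodic (n , _ , m , m<n , p , q) = n ∸ m , m<n⇒0<n∸m m<n , 4 + m , λ j m≤j → begin-equality
    u (n ∸ m + j)                              ≡⟨ cong u (index m≤j) ⟩
    u (j ∸ (4 + m) + (4 + n))                  ≡⟨ same-tail p q (j ∸ (4 + m)) ⟨
    u (j ∸ (4 + m) + (4 + m))                  ≡⟨ cong u (m∸n+n≡m m≤j) ⟩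
    u j                                        ∎
    where
    arith : ∀ d i m → d + (i + (4 + m)) ≡ i + (4 + (d + m))
    arith = solve-∀
    index : ∀ {j} → 4 + m ≤ j → n ∸ m + j ≡ j ∸ (4 + m) + (4 + n)
    index {j} m≤j = begin-equality
      n ∸ m + j                                ≡⟨ cong (n ∸ m +_) (m∸n+n≡m m≤j) ⟨
      n ∸ m + (j ∸ (4 + m) + (4 + m))          ≡⟨ arith (n ∸ m) (j ∸ (4 + m)) m ⟩
      j ∸ (4 + m) + (4 + (n ∸ m + m))          ≡⟨ cong (λ z → j ∸ (4 + m) + (4 + z)) (m∸n+n≡m (<⇒≤ m<n)) ⟩
      j ∸ (4 + m) + (4 + n)                    ∎

  -- Initial terms and the uniform bound

  u-step≤ : ∀ n {a b} → u (1 + n) ≤ a → u n ≤ b → u (2 + n) ≤ a + b + k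
  u-step≤ n p q rewrite rec n = +-monoˡ-≤ k (+-mono-≤ (≤-trans (φ≤n _) p) (≤-trans (φ≤n _) q))

  k≤W : k ≤ W
  k≤W = m≤n+m k _

  u₀≤ : u 0 ≤ W
  u₀≤ = ≤-trans (m≤m+n _ (u 1)) (m≤m+n _ k)
  u₁≤ : u 1 ≤ W
  u₁≤ = ≤-trans (m≤n+m _ (u 0)) (m≤m+n _ k)
  u₂≤ : u 2 ≤ W
  u₂≤ = ≤-trans (u-step≤ 0 ≤-refl ≤-refl) (≤-reflexive (cong (_+ k) (+-comm (u 1) (u 0))))
  u₃≤ : u 3 ≤ 2 * W
  u₃≤ = begin
    u 3                ≤⟨ u-step≤ 1 u₂≤ ≤-refl ⟩
    W + u 1 + k        ≡⟨ +-assoc W (u 1) k ⟩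
    W + (u 1 + k)      ≤⟨ +-monoʳ-≤ W (+-monoˡ-≤ k (m≤n+m (u 1) (u 0))) ⟩
    W + W              ≡⟨ cong (W +_) (+-identityʳ W) ⟨
    2 * W              ∎
  u₄≤ : u 4 ≤ 4 * W
  u₄≤ = ≤-trans (u-step≤ 2 u₃≤ u₂≤) (≤-trans (+-monoʳ-≤ (2 * W + W) k≤W) (≤-reflexive (arith W)))
    where
    arith : ∀ w → 2 * w + w + w ≡ 4 * w
    arith = solve-∀
  u₅≤ : u 5 ≤ 7 * W
  u₅≤ = ≤-trans (u-step≤ 3 u₄≤ u₃≤) (≤-trans (+-monoʳ-≤ (4 * W + 2 * W) k≤W) (≤-reflexive (arith W)))
    where
    arith : ∀ w → 4 * w + 2 * w + w ≡ 7 * w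
    arith = solve-∀

  P₀≤ : P 0 ≤ 11 * W
  P₀≤ = begin
    2 * v 1 + v 0          ≤⟨ +-monoʳ-≤ (2 * v 1) (m≤m+n (v 0) _) ⟩
    2 * v 1 + 2 * v 0      ≡⟨ cong₂ _+_ (u≡2v 1) (u≡2v 0) ⟨
    u 5 + u 4              ≤⟨ +-mono-≤ u₅≤ u₄≤ ⟩
    7 * W + 4 * W          ≡⟨ *-distribʳ-+ W 7 4 ⟨
    11 * W                 ∎

  -- Twice the linear bound on `v` at time `N`, with `P 0` replaced by `11 * W`.
  U : ℕ → ℕ
  U N = 22 * W + 2 * (N * k)

  u≤U-early : ∀ N n → n < 4 + N → u n ≤ U N
  u≤U-early N 0 _ = ≤-trans u₀≤ (≤-trans (m≤n*m W 22) (m≤m+n (22 * W) _))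
  u≤U-early N 1 _ = ≤-trans u₁≤ (≤-trans (m≤n*m W 22) (m≤m+n (22 * W) _))
  u≤U-early N 2 _ = ≤-trans u₂≤ (≤-trans (m≤n*m W 22) (m≤m+n (22 * W) _))
  u≤U-early N 3 _ = ≤-trans u₃≤ (≤-trans (*-monoˡ-≤ W (≤ᵇ⇒≤ 2 22 _)) (m≤m+n (22 * W) _))
  u≤U-early N (suc (suc (suc (suc n)))) 4+n<4+N = begin
    u (4 + n)                      ≡⟨ u≡2v n ⟩
    2 * v n                        ≤⟨ *-monoʳ-≤ 2 (v≤ n) ⟩
    2 * (P 0 + n * k)              ≤⟨ *-monoʳ-≤ 2 (+-mono-≤ P₀≤ (*-monoˡ-≤ k (<⇒≤ (+-cancelˡ-< 4 n N 4+n<4+N)))) ⟩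
    2 * (11 * W + N * k)           ≡⟨ trans (*-distribˡ-+ 2 (11 * W) (N * k)) (cong (_+ 2 * (N * k)) (sym (*-assoc 2 11 W))) ⟩
    U N                            ∎

  -- From index `4 + N` on, each term equals the one `n ∸ m` places earlier, so strong induction
  -- descends to the early range.
  repetition⇒u≤U : ∀ {N} → Repetition N → ∀ n → u n ≤ U N
  repetition⇒u≤U {N} (n , n<N , m , m<n , p , q) = <-rec _ bound
    where
    bound : ∀ j → (∀ {i} → i < j → u i ≤ U N) → u j ≤ U N
    bound j ih with j <? 4 + N
    ... | yes j< = u≤U-early N j j<
    ... | no ¬j< = subst (_≤ U N) (trans (same-tail p q (j ∸ (4 + n))) (cong u j≡)) (ih earlier)
      where
      j≡ : j ∸ (4 + n) + (4 + n) ≡ j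
      j≡ = m∸n+n≡m (≤-trans (+-monoʳ-≤ 4 (<⇒≤ n<N)) (≮⇒≥ ¬j<))
      earlier : j ∸ (4 + n) + (4 + m) < j
      earlier = subst (j ∸ (4 + n) + (4 + m) <_) j≡ (+-monoʳ-< (j ∸ (4 + n)) (+-monoʳ-< 4 m<n))

  u≤ : ∀ n → u n ≤ 4 ^ (W ^ (3 ^ (k + 1)))
  u≤ n = ≤-trans (repetition⇒u≤U repetition n) (horizon≤4^ k (P 0) W 2+k≤W P₀≤)

-- Passage from indices starting at 0 to indices starting at 1

bounded-and-periodic :
  ∀ k (u : ℕ → ℕ) → 1 ≤ u 0 → 1 ≤ u 1 →
  (∀ n → u (2 + n) ≡ φ (u (1 + n)) + φ (u n) + k) →
  (∃[ v ] (∀ n → u (4 + n) ≡ 2 * v n)) →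
  (∀ n → u n ≤ 4 ^ ((u 0 + u 1 + k) ^ (3 ^ (k + 1))))
  × (∃[ T ] (1 ≤ T × ∃[ A ] (∀ n → A ≤ n → u (T + n) ≡ u n)))
bounded-and-periodic k u 1≤u₀ 1≤u₁ rec (v , u≡2v) = u≤ , repetition⇒periodic repetition
  where open TotientSequence k u v 1≤u₀ 1≤u₁ rec u≡2v using (u≤; repetition; repetition⇒periodic)

theorem1p3 : (k : ℕ) → 2 ∣ k → (x : ℕ → ℕ) → x 1 ≥ 1 → x 2 ≥ 1 →
    (∀ n → n ≥ 1 → x (n + 2) ≡ φ (x (n + 1)) + φ (x n) + k) →
    (∀ n → n ≥ 1 →
    x n ^ (2 ^ (3 ^ (k + 1))) ≤ 4 ^ ((3 * x 1 + 5 * x 2 + 7 * k) ^ (3 ^ (k + 1))))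
    × (∃[ T ] (T ≥ 1 × ∃[ N ] (∀ n → n ≥ N → x (n + T) ≡ x n)))
theorem1p3 k 2∣k x 1≤x₁ 1≤x₂ x-rec = bounded , periodic
  where
  rec : ∀ n → x (3 + n) ≡ φ (x (2 + n)) + φ (x (1 + n)) + k
  rec n = subst₂ (λ a b → x a ≡ φ (x b) + φ (x (1 + n)) + k) (+-comm (1 + n) 2) (+-comm (1 + n) 1)
    (x-rec (1 + n) (s≤s z≤n))
  W : ℕ
  W = x 1 + x 2 + k
  x-even : ∀ n → 2 ∣ x (5 + n)
  x-even = Parity.u-even k 2∣k (λ n → x (1 + n)) 1≤x₁ 1≤x₂ rec
  main : (∀ n → x (1 + n) ≤ 4 ^ (W ^ (3 ^ (k + 1))))
         × (∃[ T ] (1 ≤ T × ∃[ A ] (∀ n → A ≤ n → x (1 + (T + n)) ≡ x (1 + n))))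
  main = bounded-and-periodic k (λ n → x (1 + n)) 1≤x₁ 1≤x₂ rec
    ((λ n → quotient (x-even n)) , λ n → trans (_∣_.equality (x-even n)) (*-comm (quotient (x-even n)) 2))
  2W≤ : 2 * W ≤ 3 * x 1 + 5 * x 2 + 7 * k
  2W≤ = begin
    2 * (x 1 + x 2 + k)                ≡⟨ arith (x 1) (x 2) k ⟩
    2 * x 1 + 2 * x 2 + 2 * k          ≤⟨ +-mono-≤ (+-mono-≤ (*-monoˡ-≤ (x 1) (≤ᵇ⇒≤ 2 3 _)) (*-monoˡ-≤ (x 2) (≤ᵇ⇒≤ 2 5 _))) (*-monoˡ-≤ k (≤ᵇ⇒≤ 2 7 _)) ⟩
    3 * x 1 + 5 * x 2 + 7 * k          ∎
    where
    open ≤-Reasoning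
    arith : ∀ a b c → 2 * (a + b + c) ≡ 2 * a + 2 * b + 2 * c
    arith = solve-∀
  bounded : ∀ n → n ≥ 1 → x n ^ (2 ^ (3 ^ (k + 1))) ≤ 4 ^ ((3 * x 1 + 5 * x 2 + 7 * k) ^ (3 ^ (k + 1)))
  bounded (suc n) _ = power-bound (3 ^ (k + 1)) W _ (x (suc n)) 2W≤ (proj₁ main n)
  periodic : ∃[ T ] (T ≥ 1 × ∃[ N ] (∀ n → n ≥ N → x (n + T) ≡ x n))
  periodic = reindex (proj₂ main)
    where
    reindex : ∃[ T ] (1 ≤ T × ∃[ A ] (∀ n → A ≤ n → x (1 + (T + n)) ≡ x (1 + n))) →
              ∃[ T ] (T ≥ 1 × ∃[ N ] (∀ n → n ≥ N → x (n + T) ≡ x n))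
    -- The recurrence says nothing about `x 0`, so the threshold `1 + A` restricts to successor
    -- indices.
    reindex (T , 1≤T , A , per) = T , 1≤T , 1 + A , λ where
      (suc n) (s≤s A≤n) → trans (cong (λ z → x (1 + z)) (+-comm n T)) (per n A≤n)
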